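{- Let $m$ be a positive integer. In each of the following cases the displayed identity holds, and the triple consisting of $n_1=6m+3$ and the denominators $n_2,n_3$ of the second and third unit fractions on the right-hand side is a wild solution of the Erdős–Straus equation for $24m+1$. (1) If $m=11r+3+c(22r+7)$ with $r,c\in\mathbb N$, then $$\frac{4}{24m+1}=\frac{1}{6m+3}+\frac{1}{2(3r+1)(2c+1)(24m+1)}+\frac{1}{6(3r+1)(2c+1)(22r+7)(24m+1)}.$$ (2) If $m=33r-1+c(66r-1)$ with $r\in\mathbb N$, $r>0$, $c\in\mathbb N$, then $$\frac{4}{24m+1}=\frac{1}{6m+3}+\frac{1}{18r(2c+1)(24m+1)}+\frac{1}{18r(2c+1)(66r-1)(24m+1)}.$$ (3) If $m=33r+21+c(66r+43)$ with $r,c\in\mathbb N$, then $$\frac{4}{24m+1}=\frac{1}{6m+3}+\frac{1}{6(3r+2)(2c+1)(24m+1)}+\frac{1}{6(3r+2)(2c+1)(66r+43)(24m+1)}.$$ (4) If $m=33r+9+c(66r+19)$ with $r\in\mathbb N$, $r>0$, $c\in\mathbb N$, then $$\frac{4}{24m+1}=\frac{1}{6m+3}+\frac{1}{6(3r+1)(2c+1)(24m+1)}+\frac{1}{2(3r+1)(2c+1)(66r+19)(24m+1)}.$$ (5) If $m=33r+20+c(66r+41)$ with $r\in\mathbb N$, $r>0$, $c\in\mathbb N$, then $$\frac{4}{24m+1}=\frac{1}{6m+3}+\frac{1}{6(3r+2)(2c+1)(24m+1)}+\frac{1}{2(3r+2)(2c+1)(66r+41)(24m+1)}.$$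
   Context: $\mathbb N$ denotes the set of nonnegative integers. For a positive integer $m$, the Erdős–Straus equation for $n=24m+1$ is $\frac{4}{n}=\frac1{n_1}+\frac1{n_2}+\frac1{n_3}$ in positive integers $n_1,n_2,n_3$. For $n_1=6m+k$ with $1\le k\le 12m$ one has $\frac{4}{24m+1}=\frac{1}{6m+k}+\frac{4k-1}{(6m+k)(24m+1)}$. A solution $(n_1,n_2,n_3)$ is called a wild solution if $n_1=6m+k$ for some integer $1\le k\le 12m$ and there exist an integer $L\ge 2$ (called a multiplier) and positive integers $J_1,J_2$ (called the numerator summands) such that $J_1+J_2=L(4k-1)$, $\gcd(L,J_1,J_2)=1$, $\frac1{n_2}=\frac{J_1}{L(6m+k)(24m+1)}$ and $\frac1{n_3}=\frac{J_2}{L(6m+k)(24m+1)}$. -}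

module Defs where

open import Data.Integer.Base using (+_)
open import Data.Nat.Base using (ℕ; NonZero; _+_; _*_; _∸_; _≤_)
open import Data.Nat.GCD using (gcd)
open import Data.Rational.Base using (_/_) renaming (_+_ to _+ℚ_)
open import Relation.Binary.PropositionalEquality using (_≡_)

record IsErdősStrausSolution (n n₁ n₂ n₃ : ℕ) : Set where
  field
    {{n≢0}}  : NonZero n
    {{n₁≢0}} : NonZero n₁
    {{n₂≢0}} : NonZero n₂
    {{n₃≢0}} : NonZero n₃
    equation : + 4 / n ≡ + 1 / n₁ +ℚ + 1 / n₂ +ℚ + 1 / n₃

-- The parameter m stands for the equation with n = 24m + 1.
record IsWildSolution (m n₁ n₂ n₃ : ℕ) : Set where
  field
    isSolution : IsErdősStrausSolution (24 * m + 1) n₁ n₂ n₃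

  open IsErdősStrausSolution isSolution public

  field
    k     : ℕ
    1≤k   : 1 ≤ k
    k≤12m : k ≤ 12 * m
    n₁≡   : n₁ ≡ 6 * m + k

    multiplier : ℕ
    J₁ J₂      : ℕ
    2≤L        : 2 ≤ multiplier
    1≤J₁       : 1 ≤ J₁
    1≤J₂       : 1 ≤ J₂

    -- The truncated subtraction is exact, since 1 ≤ k.
    sum     : J₁ + J₂ ≡ multiplier * (4 * k ∸ 1)
    coprime : gcd multiplier (gcd J₁ J₂) ≡ 1

    -- Implied by 1≤k and 2≤L; present only so that the fractions below are
    -- well formed.
    {{denominator≢0}} : NonZero (multiplier * (6 * m + k) * (24 * m + 1))
    1/n₂≡ : + 1 / n₂ ≡ + J₁ / (multiplier * (6 * m + k) * (24 * m + 1))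
    1/n₃≡ : + 1 / n₃ ≡ + J₂ / (multiplier * (6 * m + k) * (24 * m + 1))

module Submission where

open import Data.Integer.Base using (+_) renaming (_+_ to _+ℤ_)
open import Data.Integer.Properties using (pos-*; pos-+)
open import Data.Nat.Base
  using (ℕ; suc; NonZero; >-nonZero; >-nonZero⁻¹; _+_; _*_; _∸_; _≤_; _<_; s≤s; z≤n)
open import Data.Nat.Coprimality as Coprimality using (Coprime; coprime-+; coprime⇒gcd≡1; 1-coprimeTo)
open import Data.Nat.Divisibility using (_∣_; divides; ∣-trans)
open import Data.Nat.GCD using (gcd[m,n]∣n)
open import Data.Nat.Properties
  using (≤-trans; +-comm; m≤n+m; m≤n⇒m≤o+n; *-comm; *-mono-≤; *-monoʳ-≤; m≤m*n;
         m*n≢0; m*n≢0⇒m≢0; m*n≢0⇒n≢0)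
open import Data.Nat.Tactic.RingSolver using (solve-∀)
open import Data.Product.Base using (_×_; _,_)
open import Data.Rational.Base using (_/_; toℚᵘ; fromℚᵘ) renaming (_+_ to _+ℚ_)
open import Data.Rational.Properties
  using (fromℚᵘ-cong; toℚᵘ-injective; toℚᵘ-homo-+; toℚᵘ-fromℚᵘ)
open import Data.Rational.Unnormalised.Base using (ℚᵘ; mkℚᵘ; *≡*) renaming (_+_ to _+ᵘ_)
import Data.Rational.Unnormalised.Properties as ℚᵘ
open import Relation.Binary.PropositionalEquality
  using (_≡_; refl; sym; trans; cong; cong₂; subst; module ≡-Reasoning)
open import Defs

-- With k = 3 one has 4k − 1 = 11 and n₁ = 6m + 3 = 3(2m + 1), so a wild solution
-- amounts to a splitting 11L = J₁ + J₂ in which J₁ and J₂ divide L(6m + 3).  In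
-- every case q = (2m + 1)/(2c + 1) is an explicit linear form in r, and
--   (1)  L = 6r + 2,  J₁ = 3q,  J₂ = 1   q = 22r + 7
--   (2)  L = 6r,      J₁ = q,   J₂ = 1   q = 66r − 1
--   (3)  L = 6r + 4,  J₁ = q,   J₂ = 1   q = 66r + 43
--   (4)  L = 6r + 2,  J₁ = q,   J₂ = 3   q = 66r + 19
--   (5)  L = 6r + 4,  J₁ = q,   J₂ = 3   q = 66r + 41
-- Adding J₁ + J₂ = 11L over the denominator L(6m + 3)(24m + 1) gives the identity.

-- Fractions with natural numerators and denominators.

/-cross : ∀ a b c d .{{_ : NonZero b}} .{{_ : NonZero d}} →
          a * d ≡ c * b → + a / b ≡ + c / d
-- Once the denominators are successors, `+ a / suc b` unfolds to `fromℚᵘ (mkℚᵘ (+ a) b)`, and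
-- `fromℚᵘ` respects cross-multiplication.
/-cross a (suc b) c (suc d) eq =
  fromℚᵘ-cong {mkℚᵘ (+ a) b} {mkℚᵘ (+ c) d}
    (*≡* (trans (sym (pos-* a (suc d))) (trans (cong +_ eq) (pos-* c (suc b)))))

-- Normalisation hides the usual formula for a sum, so both sides are compared in `ℚᵘ`, where
-- addition is given by that formula.
+-/ : ∀ a b c d .{{_ : NonZero b}} .{{_ : NonZero d}} .{{_ : NonZero (b * d)}} →
      + a / b +ℚ + c / d ≡ + (a * d + c * b) / (b * d)
+-/ a (suc b) c (suc d) = toℚᵘ-injective (begin
  toℚᵘ (fromℚᵘ p +ℚ fromℚᵘ q)         ≈⟨ toℚᵘ-homo-+ (fromℚᵘ p) (fromℚᵘ q) ⟩
  toℚᵘ (fromℚᵘ p) +ᵘ toℚᵘ (fromℚᵘ q)  ≈⟨ ℚᵘ.+-cong (toℚᵘ-fromℚᵘ p) (toℚᵘ-fromℚᵘ q) ⟩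
  p +ᵘ q                              ≡⟨ cong (λ i → mkℚᵘ i (d + b * suc d)) numerators ⟩
  s                                   ≈⟨ toℚᵘ-fromℚᵘ s ⟨
  toℚᵘ (fromℚᵘ s)                     ∎)
  where
  open import Relation.Binary.Reasoning.Setoid ℚᵘ.≃-setoid
  p q s : ℚᵘ
  p = mkℚᵘ (+ a) b
  q = mkℚᵘ (+ c) d
  -- `mkℚᵘ` stores the denominator minus one, and `suc b * suc d` computes to `suc (d + b * suc d)`.
  s = mkℚᵘ (+ (a * suc d + c * suc b)) (d + b * suc d)
  numerators = sym (trans (pos-+ (a * suc d) (c * suc b))
                          (cong₂ _+ℤ_ (pos-* a (suc d)) (pos-* c (suc b))))

+-/-same : ∀ a b d .{{_ : NonZero d}} → + a / d +ℚ + b / d ≡ + (a + b) / d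
+-/-same a b d = trans (+-/ a d b d) (/-cross (a * d + b * d) (d * d) (a + b) d (identity a b d))
  where
  instance _ = m*n≢0 d d
  identity : ∀ a b d → (a * d + b * d) * d ≡ (a + b) * (d * d)
  identity = solve-∀

coprime-∣ʳ : ∀ {m n d} → Coprime m n → d ∣ n → Coprime m d
coprime-∣ʳ coprime d∣n (e∣m , e∣d) = coprime (e∣m , ∣-trans e∣d d∣n)

coprime-suc : ∀ n → Coprime (suc n) n
coprime-suc n = subst (λ k → Coprime k n) (+-comm n 1) (coprime-+ (1-coprimeTo n))

-- From a splitting of 11L to a wild solution with k = 3.

WildWithDenominators : ℕ → ℕ → ℕ → Set
WildWithDenominators m a b =
  IsErdősStrausSolution n (6 * m + 3) (a * n) (b * n) × IsWildSolution m (6 * m + 3) (a * n) (b * n)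
  where n = 24 * m + 1

wild : ∀ {m} L J₁ J₂ a b → 0 < m → 2 ≤ L → J₁ + J₂ ≡ L * 11 → Coprime L J₂ →
       L * (6 * m + 3) ≡ J₁ * a → L * (6 * m + 3) ≡ J₂ * b →
       WildWithDenominators m a b
wild {m} L J₁ J₂ a b 0<m 2≤L split coprime L*n₁≡J₁*a L*n₁≡J₂*b = solution , record
  { isSolution = solution
  ; k          = 3
  ; 1≤k        = s≤s z≤n
  -- The product of `3 ≤ 12` and `1 ≤ m`, with `3 * 1` computing to 3.
  ; k≤12m      = *-mono-≤ {3} {12} {1} (s≤s (s≤s (s≤s z≤n))) 0<m
  ; n₁≡        = refl
  ; multiplier = L
  ; 2≤L        = 2≤L
  ; 1≤J₁       = >-nonZero⁻¹ J₁
  ; 1≤J₂       = >-nonZero⁻¹ J₂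
  -- `4 * 3 ∸ 1` computes to 11.
  ; sum        = split
  -- `gcd J₁ J₂` divides `J₂`, so it inherits coprimality to `L`.
  ; coprime    = coprime⇒gcd≡1 (coprime-∣ʳ coprime (gcd[m,n]∣n J₁ J₂))
  ; 1/n₂≡      = fraction J₁ a L*n₁≡J₁*a
  ; 1/n₃≡      = fraction J₂ b L*n₁≡J₂*b
  }
  where
  n₁ = 6 * m + 3
  n = 24 * m + 1
  D = L * n₁ * n

  instance
    L≢0 : NonZero L
    L≢0 = >-nonZero (≤-trans (s≤s z≤n) 2≤L)
    n₁≢0 : NonZero n₁
    n₁≢0 = >-nonZero (≤-trans (s≤s z≤n) (m≤n+m 3 (6 * m)))
    n≢0 : NonZero n
    n≢0 = >-nonZero (m≤n+m 1 (24 * m))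
    L*n₁≢0 : NonZero (L * n₁)
    L*n₁≢0 = m*n≢0 L n₁
    D≢0 : NonZero D
    D≢0 = m*n≢0 (L * n₁) n
    -- The summands and the cofactors are positive because both products equal the nonzero `L * n₁`.
    J₁*a≢0 : NonZero (J₁ * a)
    J₁*a≢0 = subst NonZero L*n₁≡J₁*a L*n₁≢0
    J₂*b≢0 : NonZero (J₂ * b)
    J₂*b≢0 = subst NonZero L*n₁≡J₂*b L*n₁≢0
    J₁≢0 : NonZero J₁
    J₁≢0 = m*n≢0⇒m≢0 J₁ {a}
    J₂≢0 : NonZero J₂
    J₂≢0 = m*n≢0⇒m≢0 J₂ {b}
    a≢0 : NonZero a
    a≢0 = m*n≢0⇒n≢0 J₁
    b≢0 : NonZero b
    b≢0 = m*n≢0⇒n≢0 J₂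
    a*n≢0 : NonZero (a * n)
    a*n≢0 = m*n≢0 a n
    b*n≢0 : NonZero (b * n)
    b*n≢0 = m*n≢0 b n

  fraction : ∀ J x .{{_ : NonZero (x * n)}} → L * n₁ ≡ J * x → + 1 / (x * n) ≡ + J / D
  fraction J x eq = /-cross 1 (x * n) J D (trans (cong (λ y → 1 * (y * n)) eq) (identity J x n))
    where
    identity : ∀ J x n → 1 * (J * x * n) ≡ J * (x * n)
    identity = solve-∀

  1/n₁≡ : + 1 / n₁ ≡ + (L * n) / D
  1/n₁≡ = /-cross 1 n₁ (L * n) D (identity L n₁ n)
    where
    identity : ∀ L n₁ n → 1 * (L * n₁ * n) ≡ L * n * n₁
    identity = solve-∀

  -- The choice k = 3 enters through n + 11 = 24m + 12 = 4n₁, whence Ln + 11L = 4Ln₁.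
  numerator : (L * n + J₁ + J₂) * n ≡ 4 * D
  numerator = begin
    (L * n + J₁ + J₂) * n    ≡⟨ reassoc (L * n) J₁ J₂ n ⟩
    (L * n + (J₁ + J₂)) * n  ≡⟨ cong (λ s → (L * n + s) * n) split ⟩
    (L * n + L * 11) * n     ≡⟨ identity L m ⟩
    4 * D                    ∎
    where
    open ≡-Reasoning
    reassoc : ∀ p q r n → (p + q + r) * n ≡ (p + (q + r)) * n
    reassoc = solve-∀
    identity : ∀ L m → (L * (24 * m + 1) + L * 11) * (24 * m + 1)
                     ≡ 4 * (L * (6 * m + 3) * (24 * m + 1))
    identity = solve-∀

  equation : + 4 / n ≡ + 1 / n₁ +ℚ + 1 / (a * n) +ℚ + 1 / (b * n)
  equation = begin
    + 4 / n                                      ≡⟨ /-cross 4 n (L * n + J₁ + J₂) D (sym numerator) ⟩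
    + (L * n + J₁ + J₂) / D                      ≡⟨ +-/-same (L * n + J₁) J₂ D ⟨
    + (L * n + J₁) / D +ℚ + J₂ / D               ≡⟨ cong (_+ℚ + J₂ / D) (+-/-same (L * n) J₁ D) ⟨
    + (L * n) / D +ℚ + J₁ / D +ℚ + J₂ / D        ≡⟨ cong₂ _+ℚ_ (cong₂ _+ℚ_ 1/n₁≡ (fraction J₁ a L*n₁≡J₁*a)) (fraction J₂ b L*n₁≡J₂*b) ⟨
    + 1 / n₁ +ℚ + 1 / (a * n) +ℚ + 1 / (b * n)   ∎
    where open ≡-Reasoning

  solution : IsErdősStrausSolution n n₁ (a * n) (b * n)
  solution = record { equation = equation }

-- The successor 6r + 3 is a multiple of 3, and consecutive numbers are coprime.
coprime-2[3r+1]-3 : ∀ r → Coprime (2 * (3 * r + 1)) 3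
coprime-2[3r+1]-3 r =
  coprime-∣ʳ (Coprimality.sym (coprime-suc (2 * (3 * r + 1)))) (divides (2 * r + 1) (identity r))
  where
  identity : ∀ r → suc (2 * (3 * r + 1)) ≡ (2 * r + 1) * 3
  identity = solve-∀

-- Here it is the predecessor 6r + 3 that is a multiple of 3.
coprime-2[3r+2]-3 : ∀ r → Coprime (2 * (3 * r + 2)) 3
coprime-2[3r+2]-3 r =
  coprime-∣ʳ (subst (λ L → Coprime L (3 * (2 * r + 1))) (identity r) (coprime-suc (3 * (2 * r + 1))))
             (divides (2 * r + 1) (*-comm 3 (2 * r + 1)))
  where
  identity : ∀ r → suc (3 * (2 * r + 1)) ≡ 2 * (3 * r + 2)
  identity = solve-∀

-- The five families.

case₁ : ∀ r c → let m = 11 * r + 3 + c * (22 * r + 7) in 0 < m →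
        WildWithDenominators m (2 * (3 * r + 1) * (2 * c + 1))
                               (6 * (3 * r + 1) * (2 * c + 1) * (22 * r + 7))
case₁ r c 0<m =
  -- With q = 22r + 7, m = (q - 1)/2 + cq, so 2m + 1 = q(2c + 1) and L(6m + 3) = 3Lq(2c + 1).
  -- Dividing by 3q and by 1 gives the two cofactors; the other cases follow the same pattern.
  wild (2 * (3 * r + 1)) (3 * (22 * r + 7)) 1 (2 * (3 * r + 1) * (2 * c + 1))
    (6 * (3 * r + 1) * (2 * c + 1) * (22 * r + 7)) 0<m
    (*-monoʳ-≤ 2 (m≤n+m 1 (3 * r)))
    (sum r) (Coprimality.sym (1-coprimeTo _)) (eq₂ r c) (eq₃ r c)
  where
  sum : ∀ r → 3 * (22 * r + 7) + 1 ≡ 2 * (3 * r + 1) * 11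
  sum = solve-∀
  eq₂ : ∀ r c → 2 * (3 * r + 1) * (6 * (11 * r + 3 + c * (22 * r + 7)) + 3)
              ≡ 3 * (22 * r + 7) * (2 * (3 * r + 1) * (2 * c + 1))
  eq₂ = solve-∀
  eq₃ : ∀ r c → 2 * (3 * r + 1) * (6 * (11 * r + 3 + c * (22 * r + 7)) + 3)
              ≡ 1 * (6 * (3 * r + 1) * (2 * c + 1) * (22 * r + 7))
  eq₃ = solve-∀

-- For case (2) at 1 + r: 33 * suc r ∸ 1 and 66 * suc r ∸ 1 compute to
-- r + 32 * (1 + r) and r + 65 * (1 + r), so no truncated subtraction reaches the solver.
case₂ : ∀ r c → let m = r + 32 * (1 + r) + c * (r + 65 * (1 + r)) in 0 < m →
        WildWithDenominators m (18 * (1 + r) * (2 * c + 1))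
                               (18 * (1 + r) * (2 * c + 1) * (r + 65 * (1 + r)))
case₂ r c 0<m =
  wild (6 * (1 + r)) (r + 65 * (1 + r)) 1 (18 * (1 + r) * (2 * c + 1))
    (18 * (1 + r) * (2 * c + 1) * (r + 65 * (1 + r))) 0<m
    (≤-trans (s≤s (s≤s z≤n)) (m≤m*n 6 (1 + r)))
    (sum r) (Coprimality.sym (1-coprimeTo _)) (eq₂ r c) (eq₃ r c)
  where
  sum : ∀ r → r + 65 * (1 + r) + 1 ≡ 6 * (1 + r) * 11
  sum = solve-∀
  eq₂ : ∀ r c → 6 * (1 + r) * (6 * (r + 32 * (1 + r) + c * (r + 65 * (1 + r))) + 3)
              ≡ (r + 65 * (1 + r)) * (18 * (1 + r) * (2 * c + 1))
  eq₂ = solve-∀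
  eq₃ : ∀ r c → 6 * (1 + r) * (6 * (r + 32 * (1 + r) + c * (r + 65 * (1 + r))) + 3)
              ≡ 1 * (18 * (1 + r) * (2 * c + 1) * (r + 65 * (1 + r)))
  eq₃ = solve-∀

case₃ : ∀ r c → let m = 33 * r + 21 + c * (66 * r + 43) in 0 < m →
        WildWithDenominators m (6 * (3 * r + 2) * (2 * c + 1))
                               (6 * (3 * r + 2) * (2 * c + 1) * (66 * r + 43))
case₃ r c 0<m =
  wild (2 * (3 * r + 2)) (66 * r + 43) 1 (6 * (3 * r + 2) * (2 * c + 1))
    (6 * (3 * r + 2) * (2 * c + 1) * (66 * r + 43)) 0<m
    (*-monoʳ-≤ 2 (m≤n⇒m≤o+n (3 * r) (s≤s z≤n)))
    (sum r) (Coprimality.sym (1-coprimeTo _)) (eq₂ r c) (eq₃ r c)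
  where
  sum : ∀ r → 66 * r + 43 + 1 ≡ 2 * (3 * r + 2) * 11
  sum = solve-∀
  eq₂ : ∀ r c → 2 * (3 * r + 2) * (6 * (33 * r + 21 + c * (66 * r + 43)) + 3)
              ≡ (66 * r + 43) * (6 * (3 * r + 2) * (2 * c + 1))
  eq₂ = solve-∀
  eq₃ : ∀ r c → 2 * (3 * r + 2) * (6 * (33 * r + 21 + c * (66 * r + 43)) + 3)
              ≡ 1 * (6 * (3 * r + 2) * (2 * c + 1) * (66 * r + 43))
  eq₃ = solve-∀

-- The multiplier is that of `case₁`, with the factor 3 moved from the first summand to the second:
-- 11L = q + 3 in place of 3q + 1. Coprimality now rests on 3 not dividing L.
case₄ : ∀ r c → let m = 33 * r + 9 + c * (66 * r + 19) in 0 < m →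
        WildWithDenominators m (6 * (3 * r + 1) * (2 * c + 1))
                               (2 * (3 * r + 1) * (2 * c + 1) * (66 * r + 19))
case₄ r c 0<m =
  wild (2 * (3 * r + 1)) (66 * r + 19) 3 (6 * (3 * r + 1) * (2 * c + 1))
    (2 * (3 * r + 1) * (2 * c + 1) * (66 * r + 19)) 0<m
    (*-monoʳ-≤ 2 (m≤n+m 1 (3 * r)))
    (sum r) (coprime-2[3r+1]-3 r) (eq₂ r c) (eq₃ r c)
  where
  sum : ∀ r → 66 * r + 19 + 3 ≡ 2 * (3 * r + 1) * 11
  sum = solve-∀
  eq₂ : ∀ r c → 2 * (3 * r + 1) * (6 * (33 * r + 9 + c * (66 * r + 19)) + 3)
              ≡ (66 * r + 19) * (6 * (3 * r + 1) * (2 * c + 1))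
  eq₂ = solve-∀
  eq₃ : ∀ r c → 2 * (3 * r + 1) * (6 * (33 * r + 9 + c * (66 * r + 19)) + 3)
              ≡ 3 * (2 * (3 * r + 1) * (2 * c + 1) * (66 * r + 19))
  eq₃ = solve-∀

-- The multiplier is that of `case₃`, with 11L split as q + 3 in place of q + 1.
case₅ : ∀ r c → let m = 33 * r + 20 + c * (66 * r + 41) in 0 < m →
        WildWithDenominators m (6 * (3 * r + 2) * (2 * c + 1))
                               (2 * (3 * r + 2) * (2 * c + 1) * (66 * r + 41))
case₅ r c 0<m =
  wild (2 * (3 * r + 2)) (66 * r + 41) 3 (6 * (3 * r + 2) * (2 * c + 1))
    (2 * (3 * r + 2) * (2 * c + 1) * (66 * r + 41)) 0<m
    (*-monoʳ-≤ 2 (m≤n⇒m≤o+n (3 * r) (s≤s z≤n)))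
    (sum r) (coprime-2[3r+2]-3 r) (eq₂ r c) (eq₃ r c)
  where
  sum : ∀ r → 66 * r + 41 + 3 ≡ 2 * (3 * r + 2) * 11
  sum = solve-∀
  eq₂ : ∀ r c → 2 * (3 * r + 2) * (6 * (33 * r + 20 + c * (66 * r + 41)) + 3)
              ≡ (66 * r + 41) * (6 * (3 * r + 2) * (2 * c + 1))
  eq₂ = solve-∀
  eq₃ : ∀ r c → 2 * (3 * r + 2) * (6 * (33 * r + 20 + c * (66 * r + 41)) + 3)
              ≡ 3 * (2 * (3 * r + 2) * (2 * c + 1) * (66 * r + 41))
  eq₃ = solve-∀

theorem3p3 : (m : ℕ) → 0 < m →
    ((r c : ℕ) → m ≡ 11 * r + 3 + c * (22 * r + 7) →
      let n₂ = 2 * (3 * r + 1) * (2 * c + 1) * (24 * m + 1)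
          n₃ = 6 * (3 * r + 1) * (2 * c + 1) * (22 * r + 7) * (24 * m + 1)
      in IsErdősStrausSolution (24 * m + 1) (6 * m + 3) n₂ n₃
         × IsWildSolution m (6 * m + 3) n₂ n₃)
  × ((r c : ℕ) → 0 < r → m ≡ (33 * r ∸ 1) + c * (66 * r ∸ 1) →
      let n₂ = 18 * r * (2 * c + 1) * (24 * m + 1)
          n₃ = 18 * r * (2 * c + 1) * (66 * r ∸ 1) * (24 * m + 1)
      in IsErdősStrausSolution (24 * m + 1) (6 * m + 3) n₂ n₃
         × IsWildSolution m (6 * m + 3) n₂ n₃)
  × ((r c : ℕ) → m ≡ 33 * r + 21 + c * (66 * r + 43) →
      let n₂ = 6 * (3 * r + 2) * (2 * c + 1) * (24 * m + 1)
          n₃ = 6 * (3 * r + 2) * (2 * c + 1) * (66 * r + 43) * (24 * m + 1)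
      in IsErdősStrausSolution (24 * m + 1) (6 * m + 3) n₂ n₃
         × IsWildSolution m (6 * m + 3) n₂ n₃)
  × ((r c : ℕ) → 0 < r → m ≡ 33 * r + 9 + c * (66 * r + 19) →
      let n₂ = 6 * (3 * r + 1) * (2 * c + 1) * (24 * m + 1)
          n₃ = 2 * (3 * r + 1) * (2 * c + 1) * (66 * r + 19) * (24 * m + 1)
      in IsErdősStrausSolution (24 * m + 1) (6 * m + 3) n₂ n₃
         × IsWildSolution m (6 * m + 3) n₂ n₃)
  × ((r c : ℕ) → 0 < r → m ≡ 33 * r + 20 + c * (66 * r + 41) →
      let n₂ = 6 * (3 * r + 2) * (2 * c + 1) * (24 * m + 1)
          n₃ = 2 * (3 * r + 2) * (2 * c + 1) * (66 * r + 41) * (24 * m + 1)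
      in IsErdősStrausSolution (24 * m + 1) (6 * m + 3) n₂ n₃
         × IsWildSolution m (6 * m + 3) n₂ n₃)
theorem3p3 m 0<m =
    (λ { r c refl → case₁ r c 0<m })
  -- `0 < 0` is empty, so only successors occur, and the bound `r` is the predecessor of the
  -- parameter.
  , (λ { (suc r) c _ refl → case₂ r c 0<m })
  , (λ { r c refl → case₃ r c 0<m })
  , (λ { r c _ refl → case₄ r c 0<m })
  , (λ { r c _ refl → case₅ r c 0<m })
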